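{- Let $\overrightarrow{W}$ be a Morse sequence on a simplicial complex $K$, with reference map $\curlywedge$ and coreference map $\curlyvee$. (1) If $z,z'\in Z_p(K)$ satisfy $\curlywedge(z)=\curlywedge(z')$ and $z,z'\subseteq W^+_p$, then $z=z'$. (2) If $z,z'\in Z^p(K)$ satisfy $\curlyvee(z)=\curlyvee(z')$ and $z,z'\subseteq K\setminus W^-_p$, then $z=z'$.
   Context: A simplicial complex $K$ is a finite collection of non-empty finite sets closed under taking non-empty subsets; $\dim\sigma=|\sigma|-1$, $K^{(p)}$ the set of $p$-simplices. A pair $(\sigma,\tau)$ with $\sigma\subsetneq\tau$ is a free pair for $K$ if $\tau$ is the only simplex other than $\sigma$ containing $\sigma$; $K$ is then an elementary expansion of $K\setminus\{\sigma,\tau\}$. If $\nu$ is a facet (maximal simplex) of $K$, $K$ is an elementary filling of $K\setminus\{\nu\}$. A Morse sequence on $K$ is a sequence $\langle\emptyset=K_0,\dots,K_k=K\rangle$ with each $K_i$ an elementary expansion or filling of $K_{i-1}$; simplices added by fillings are critical; for an expansion $K_i=K_{i-1}\cup\{\sigma,\tau\}$, $\sigma\subset\tau$, $(\sigma,\tau)$ is a regular pair, $\sigma$ lower regular, $\tau$ upper regular; $\widehat W,\underline W,\overline W$ denote the sets of critical, lower regular and upper regular simplices. $K[p]$ is the $\mathbb{Z}_2$-vector space of subsets of $K^{(p)}$ (sum = symmetric difference, $0=\emptyset$). For $\sigma\in K^{(p)}$, $\partial(\sigma)=\{\tau\in K^{(p-1)}:\tau\subset\sigma\}$, $\delta(\sigma)=\{\tau\in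 K^{(p+1)}:\sigma\subset\tau\}$, extended linearly; $Z_p(K)=\ker(\partial:K[p]\to K[p-1])$ (cycles) and $Z^p(K)=\ker(\delta:K[p]\to K[p+1])$ (cocycles). The reference map $\curlywedge$ is the unique map assigning to each $p$-simplex a set of critical $p$-simplices, extended linearly (mod 2), with $\curlywedge(\nu)=\{\nu\}$ for critical $\nu$ and $\curlywedge(\tau)=0=\curlywedge(\partial(\tau))$ for upper regular $\tau$; the coreference map $\curlyvee$ is the unique such map with $\curlyvee(\nu)=\{\nu\}$ for critical $\nu$ and $\curlyvee(\sigma)=0=\curlyvee(\delta(\sigma))$ for lower regular $\sigma$. Skeletons: $W^-_p=\{\nu\in\overline W:\dim\nu\le p\}\cup\{\nu\in\widehat W\cup\underline W:\dim\nu\le p-1\}$, $W^+_p=\{\nu\in\widehat W\cup\overline W:\dim\nu\le p\}\cup\{\nu\in\underline W:\dim\nu\le p-1\}$. -}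

module Defs where

open import Data.Bool using (Bool; true; false; _∧_; _xor_)
import Data.Bool.Properties as Bool
open import Data.Empty using (⊥)
open import Data.Fin.Subset using (Subset; inside; outside; Nonempty; ∣_∣; _⊆_; _⊂_)
open import Data.Fin.Subset.Properties using (_⊂?_)
open import Data.List using (List; map; foldr; filterᵇ; _++_) renaming ([] to []ˡ; _∷_ to _∷ˡ_)
open import Data.Nat using (ℕ; zero; suc; pred; _≤_; _<_; _≟_)
open import Data.Product using (_×_)
open import Data.Sum using (_⊎_)
open import Data.Vec using ([]; _∷_)
open import Data.Vec.Properties using (≡-dec)
open import Function.Bundles using (_⇔_)
open import Level using (0ℓ)
open import Relation.Binary.PropositionalEquality using (_≡_; _≢_; _≗_)
open import Relation.Nullary using (¬_)
open import Relation.Nullary.Decidable using (⌊_⌋)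
open import Relation.Unary using (Pred)

private
  variable
    n : ℕ

-- Finite sets of vertices are subsets of Fin n, with n arbitrary.  Sets of
-- such sets are given by characteristic functions, and their equality is
-- pointwise (_≗_).

SimplexSet : ℕ → Set
SimplexSet n = Subset n → Bool

infix 4 _∈ˢ_ _⊆ˢ_

_∈ˢ_ : Subset n → SimplexSet n → Set
σ ∈ˢ S = S σ ≡ true

_⊆ˢ_ : SimplexSet n → Pred (Subset n) 0ℓ → Set
S ⊆ˢ P = ∀ {σ} → σ ∈ˢ S → P σ

∅ : SimplexSet n
∅ _ = false

｛_｝ : Subset n → SimplexSet n
｛ ν ｝ σ = ⌊ ≡-dec Bool._≟_ σ ν ⌋

infixr 6 _⊕_

-- Symmetric difference.
_⊕_ : SimplexSet n → SimplexSet n → SimplexSet n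
(S ⊕ T) σ = S σ xor T σ

allSubsets : (n : ℕ) → List (Subset n)
allSubsets zero    = [] ∷ˡ []ˡ
allSubsets (suc n) = map (outside ∷_) (allSubsets n) ++ map (inside ∷_) (allSubsets n)

-- Linear extension mod 2: linear f c is the sum of f σ over σ ∈ c.
linear : (Subset n → SimplexSet n) → SimplexSet n → SimplexSet n
linear {n} f c = foldr _⊕_ ∅ (map f (filterᵇ c (allSubsets n)))

-- Only meaningful on non-empty sets; every use below concerns members of a
-- complex.
dim : Subset n → ℕ
dim σ = pred ∣ σ ∣

record SimplicialComplex (n : ℕ) : Set where
  field
    simplices : SimplexSet n
    nonempty  : ∀ {σ} → σ ∈ˢ simplices → Nonempty σ
    closed    : ∀ {σ τ} → τ ∈ˢ simplices → Nonempty σ → σ ⊆ τ → σ ∈ˢ simplices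

open SimplicialComplex public

infix 4 _∈ᴷ_

_∈ᴷ_ : Subset n → SimplicialComplex n → Set
σ ∈ᴷ K = σ ∈ˢ simplices K

record FreePair (K : SimplicialComplex n) (σ τ : Subset n) : Set where
  field
    lower∈ : σ ∈ᴷ K
    upper∈ : τ ∈ᴷ K
    proper : σ ⊂ τ
    only   : ∀ {ρ} → ρ ∈ᴷ K → σ ⊆ ρ → ρ ≢ σ → ρ ≡ τ

record Facet (K : SimplicialComplex n) (ν : Subset n) : Set where
  field
    member  : ν ∈ᴷ K
    maximal : ∀ {ρ} → ρ ∈ᴷ K → ν ⊆ ρ → ρ ≡ ν

-- L is an elementary expansion of K = L ∖ {σ , τ}.
record Expansion (K L : SimplicialComplex n) (σ τ : Subset n) : Set where
  field
    free   : FreePair L σ τ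
    remove : ∀ ρ → ρ ∈ᴷ K ⇔ (ρ ∈ᴷ L × ρ ≢ σ × ρ ≢ τ)

-- L is an elementary filling of K = L ∖ {ν}.
record Filling (K L : SimplicialComplex n) (ν : Subset n) : Set where
  field
    facet  : Facet L ν
    remove : ∀ ρ → ρ ∈ᴷ K ⇔ (ρ ∈ᴷ L × ρ ≢ ν)

-- Sequences ⟨∅ = K₀, …, Kₖ = K⟩, indexed by their last complex K.
data MorseSequence {n : ℕ} : SimplicialComplex n → Set where
  start  : ∀ {K} → simplices K ≗ ∅ → MorseSequence K
  expand : ∀ {K L} → MorseSequence K → (σ τ : Subset n) → Expansion K L σ τ → MorseSequence L
  fill   : ∀ {K L} → MorseSequence K → (ν : Subset n) → Filling K L ν → MorseSequence L

Critical : {K : SimplicialComplex n} → MorseSequence K → Pred (Subset n) 0ℓ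
Critical (start _)        ρ = ⊥
Critical (expand W _ _ _) ρ = Critical W ρ
Critical (fill W ν _)     ρ = ρ ≡ ν ⊎ Critical W ρ

LowerRegular : {K : SimplicialComplex n} → MorseSequence K → Pred (Subset n) 0ℓ
LowerRegular (start _)        ρ = ⊥
LowerRegular (expand W σ _ _) ρ = ρ ≡ σ ⊎ LowerRegular W ρ
LowerRegular (fill W _ _)     ρ = LowerRegular W ρ

UpperRegular : {K : SimplicialComplex n} → MorseSequence K → Pred (Subset n) 0ℓ
UpperRegular (start _)        ρ = ⊥
UpperRegular (expand W _ τ _) ρ = ρ ≡ τ ⊎ UpperRegular W ρ
UpperRegular (fill W _ _)     ρ = UpperRegular W ρ

boundary : SimplicialComplex n → Subset n → SimplexSet n
boundary K σ τ = simplices K τ ∧ ⌊ suc (dim τ) ≟ dim σ ⌋ ∧ ⌊ τ ⊂? σ ⌋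

coboundary : SimplicialComplex n → Subset n → SimplexSet n
coboundary K σ τ = simplices K τ ∧ ⌊ dim τ ≟ suc (dim σ) ⌋ ∧ ⌊ σ ⊂? τ ⌋

∂ : SimplicialComplex n → SimplexSet n → SimplexSet n
∂ K = linear (boundary K)

δ : SimplicialComplex n → SimplexSet n → SimplexSet n
δ K = linear (coboundary K)

-- Membership in K[p].
IsChain : SimplicialComplex n → ℕ → SimplexSet n → Set
IsChain K p c = c ⊆ˢ λ σ → σ ∈ᴷ K × dim σ ≡ p

record IsCycle (K : SimplicialComplex n) (p : ℕ) (z : SimplexSet n) : Set where
  field
    chain  : IsChain K p z
    closed : ∂ K z ≗ ∅

record IsCocycle (K : SimplicialComplex n) (p : ℕ) (z : SimplexSet n) : Set where
  field
    chain  : IsChain K p z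
    closed : δ K z ≗ ∅

-- The values of a (co)reference map matter only on the simplices of K.

record IsReference {K : SimplicialComplex n} (W : MorseSequence K)
                   (⋏ : Subset n → SimplexSet n) : Set where
  field
    values         : ∀ {σ} → σ ∈ᴷ K → ⋏ σ ⊆ˢ λ ν → Critical W ν × dim ν ≡ dim σ
    critical       : ∀ {ν} → Critical W ν → ⋏ ν ≗ ｛ ν ｝
    upper          : ∀ {τ} → UpperRegular W τ → ⋏ τ ≗ ∅
    upper-boundary : ∀ {τ} → UpperRegular W τ → linear ⋏ (boundary K τ) ≗ ∅

record IsCoreference {K : SimplicialComplex n} (W : MorseSequence K)
                     (⋎ : Subset n → SimplexSet n) : Set where
  field
    values           : ∀ {σ} → σ ∈ᴷ K → ⋎ σ ⊆ˢ λ ν → Critical W ν × dim ν ≡ dim σ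
    critical         : ∀ {ν} → Critical W ν → ⋎ ν ≗ ｛ ν ｝
    lower            : ∀ {σ} → LowerRegular W σ → ⋎ σ ≗ ∅
    lower-coboundary : ∀ {σ} → LowerRegular W σ → linear ⋎ (coboundary K σ) ≗ ∅

-- In both skeletons, dim ν < p renders dim ν ≤ p - 1, also for p = 0.

W⁻ : {K : SimplicialComplex n} → MorseSequence K → ℕ → Pred (Subset n) 0ℓ
W⁻ W p ν = (UpperRegular W ν × dim ν ≤ p) ⊎ ((Critical W ν ⊎ LowerRegular W ν) × dim ν < p)

W⁺ : {K : SimplicialComplex n} → MorseSequence K → ℕ → Pred (Subset n) 0ℓ
W⁺ W p ν = ((Critical W ν ⊎ UpperRegular W ν) × dim ν ≤ p) ⊎ (LowerRegular W ν × dim ν < p)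

-- K ∖ W⁻ₚ.
W⁻ᶜ : {K : SimplicialComplex n} → MorseSequence K → ℕ → Pred (Subset n) 0ℓ
W⁻ᶜ {K = K} W p ν = ν ∈ᴷ K × ¬ W⁻ W p ν

{-# OPTIONS --safe #-}
module Submission where

-- Put c = z ⊕ z′.  The hypotheses on the supports and on the (co)reference
-- leave no critical simplex in c, so c consists of upper (resp. lower) regular
-- simplices only.  In the homological case, if τ is the upper simplex of c
-- added last, with lower partner σ, then freeness of the pair makes τ the only
-- coface of σ in c, so σ ∈ ∂ c.  Dually, if σ is the lower simplex of c added
-- first, with upper partner τ, then σ is the only face of τ in c, so τ ∈ δ c.

open import Defs
open import Data.Bool using (Bool; true; false; _∧_; _xor_)
import Data.Bool.Properties as Bool
open import Data.Fin using (zero; suc)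
open import Data.Fin.Subset using (Subset; inside; outside; Nonempty; ∣_∣; _⊆_; _⊂_; _∪_; ⁅_⁆; _∈_; _∉_)
open import Data.Fin.Subset.Properties using (_⊂?_; p⊆p∪q; q⊆p∪q; x∈p∪q⁻; x∈⁅x⁆; x∈⁅y⁆⇒x≡y; ∪-identityʳ; x∈p⇒∣p-x∣<∣p∣)
open import Data.List using (List; []; _∷_; map; foldr; filterᵇ; _++_)
open import Data.List.Properties using (map-cong; map-∘; map-++)
open import Data.Nat using (ℕ; suc; pred; _≟_; >-nonZero)
open import Data.Nat.Properties using (suc-pred; m<n⇒0<n; ≤-reflexive; <-irrefl)
open import Data.Product using (_×_; _,_; proj₁; proj₂)
open import Data.Sum using (_⊎_; inj₁; inj₂; [_,_])
open import Data.Vec using (here; there; tail) renaming ([] to []ᵛ; _∷_ to _∷ᵛ_)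
open import Data.Vec.Properties using (≡-dec)
open import Function using (_∘_; id)
open import Function.Bundles using (module Equivalence)
open import Relation.Binary.PropositionalEquality using (_≡_; _≢_; _≗_; refl; sym; trans; cong; cong₂; subst; module ≡-Reasoning)
open import Relation.Nullary using (¬_; Dec; yes; no; contradiction)
open import Relation.Nullary.Decidable using (⌊_⌋; dec-true; isYes≗does)

open ≡-Reasoning

-- Booleans and symmetric differences

⌊⌋≡true⇒ : {A : Set} (a? : Dec A) → ⌊ a? ⌋ ≡ true → A
⌊⌋≡true⇒ (yes a) _ = a

⇒⌊⌋≡true : {A : Set} (a? : Dec A) → A → ⌊ a? ⌋ ≡ true
⇒⌊⌋≡true a? a = trans (isYes≗does a?) (dec-true a? a)

xor≡false⇒≡ : ∀ x y → x xor y ≡ false → x ≡ y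
xor≡false⇒≡ true  true  _ = refl
xor≡false⇒≡ false false _ = refl

xor-interchange : ∀ w x y z → (w xor x) xor (y xor z) ≡ (w xor y) xor (x xor z)
xor-interchange w x y z = begin
  (w xor x) xor (y xor z)  ≡⟨ Bool.xor-assoc w x (y xor z) ⟩
  w xor (x xor (y xor z))  ≡⟨ cong (w xor_) (Bool.xor-assoc x y z) ⟨
  w xor ((x xor y) xor z)  ≡⟨ cong (λ u → w xor (u xor z)) (Bool.xor-comm x y) ⟩
  w xor ((y xor x) xor z)  ≡⟨ cong (w xor_) (Bool.xor-assoc y x z) ⟩
  w xor (y xor (x xor z))  ≡⟨ Bool.xor-assoc w y (x xor z) ⟨
  (w xor y) xor (x xor z)  ∎

∈-⊕⁻ : ∀ {n} (S T : SimplexSet n) {σ} → σ ∈ˢ S ⊕ T → σ ∈ˢ S ⊎ σ ∈ˢ T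
∈-⊕⁻ S T {σ} σ∈S⊕T with S σ
... | true  = inj₁ refl
... | false = inj₂ σ∈S⊕T

⊕⊆ : ∀ {n} {S T : SimplexSet n} {P : Subset n → Set} → S ⊆ˢ P → T ⊆ˢ P → S ⊕ T ⊆ˢ P
⊕⊆ {S = S} {T} S⊆P T⊆P = [ S⊆P , T⊆P ] ∘ ∈-⊕⁻ S T

-- Sums mod 2

parity : List Bool → Bool
parity = foldr _xor_ false

parity-++ : ∀ xs ys → parity (xs ++ ys) ≡ parity xs xor parity ys
parity-++ []       ys = refl
parity-++ (x ∷ xs) ys = trans (cong (x xor_) (parity-++ xs ys))
                              (sym (Bool.xor-assoc x (parity xs) (parity ys)))

parity-xor : {A : Set} (g h : A → Bool) (xs : List A) →
             parity (map (λ x → g x xor h x) xs) ≡ parity (map g xs) xor parity (map h xs)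
parity-xor g h []       = refl
parity-xor g h (x ∷ xs) =
  trans (cong ((g x xor h x) xor_) (parity-xor g h xs))
        (xor-interchange (g x) (h x) (parity (map g xs)) (parity (map h xs)))

parity-false : {A : Set} (g : A → Bool) → (∀ x → g x ≢ true) → ∀ xs → parity (map g xs) ≡ false
parity-false g g≢true []       = refl
parity-false g g≢true (x ∷ xs) = cong₂ _xor_ (Bool.¬-not (g≢true x)) (parity-false g g≢true xs)

parity-allSubsets-suc : ∀ {n} (g : Subset (suc n) → Bool) →
  parity (map g (allSubsets (suc n))) ≡
  parity (map (g ∘ (outside ∷ᵛ_)) (allSubsets n)) xor parity (map (g ∘ (inside ∷ᵛ_)) (allSubsets n))
parity-allSubsets-suc {n} g = begin
  parity (map g (map (outside ∷ᵛ_) A ++ map (inside ∷ᵛ_) A))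
    ≡⟨ cong parity (map-++ g (map (outside ∷ᵛ_) A) (map (inside ∷ᵛ_) A)) ⟩
  parity (map g (map (outside ∷ᵛ_) A) ++ map g (map (inside ∷ᵛ_) A))
    ≡⟨ parity-++ (map g (map (outside ∷ᵛ_) A)) (map g (map (inside ∷ᵛ_) A)) ⟩
  parity (map g (map (outside ∷ᵛ_) A)) xor parity (map g (map (inside ∷ᵛ_) A))
    ≡⟨ cong₂ (λ xs ys → parity xs xor parity ys) (map-∘ A) (map-∘ A) ⟨
  parity (map (g ∘ (outside ∷ᵛ_)) A) xor parity (map (g ∘ (inside ∷ᵛ_)) A)
    ∎
  where A = allSubsets n

-- At each vertex, membership in `σ` selects one half of `allSubsets`; on the other half `g`
-- vanishes, so induction applies to the selected half. The value `g σ` itself may be false.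
parity-single : ∀ {n} (g : Subset n → Bool) (σ : Subset n) → (∀ ρ → g ρ ≡ true → ρ ≡ σ) →
                parity (map g (allSubsets n)) ≡ g σ
parity-single g []ᵛ            only = Bool.xor-identityʳ (g []ᵛ)
parity-single g (outside ∷ᵛ σ) only = begin
  parity (map g (allSubsets _))
    ≡⟨ parity-allSubsets-suc g ⟩
  parity (map (g ∘ (outside ∷ᵛ_)) (allSubsets _)) xor parity (map (g ∘ (inside ∷ᵛ_)) (allSubsets _))
    ≡⟨ cong₂ _xor_
         (parity-single (g ∘ (outside ∷ᵛ_)) σ λ ρ gρ → cong tail (only (outside ∷ᵛ ρ) gρ))
         (parity-false (g ∘ (inside ∷ᵛ_)) (λ ρ gρ → contradiction (only (inside ∷ᵛ ρ) gρ) λ ())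
                       (allSubsets _)) ⟩
  g (outside ∷ᵛ σ) xor false
    ≡⟨ Bool.xor-identityʳ _ ⟩
  g (outside ∷ᵛ σ)
    ∎
parity-single g (inside ∷ᵛ σ) only = begin
  parity (map g (allSubsets _))
    ≡⟨ parity-allSubsets-suc g ⟩
  parity (map (g ∘ (outside ∷ᵛ_)) (allSubsets _)) xor parity (map (g ∘ (inside ∷ᵛ_)) (allSubsets _))
    ≡⟨ cong₂ _xor_
         (parity-false (g ∘ (outside ∷ᵛ_)) (λ ρ gρ → contradiction (only (outside ∷ᵛ ρ) gρ) λ ())
                       (allSubsets _))
         (parity-single (g ∘ (inside ∷ᵛ_)) σ λ ρ gρ → cong tail (only (inside ∷ᵛ ρ) gρ)) ⟩
  g (inside ∷ᵛ σ)
    ∎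

-- Turning the filter by `c` into a factor `c σ` makes every sum run over the same list, so that
-- sums for different chains can be compared term by term.
linear≡parity : ∀ {n} (f : Subset n → SimplexSet n) (c : SimplexSet n) (τ : Subset n) →
                linear f c τ ≡ parity (map (λ σ → c σ ∧ f σ τ) (allSubsets n))
linear≡parity {n} f c τ = go (allSubsets n)
  where
  go : ∀ xs → foldr _⊕_ ∅ (map f (filterᵇ c xs)) τ ≡ parity (map (λ σ → c σ ∧ f σ τ) xs)
  go []       = refl
  go (σ ∷ xs) with c σ
  ... | true  = cong (f σ τ xor_) (go xs)
  ... | false = go xs

linear-⊕ : ∀ {n} (f : Subset n → SimplexSet n) (c d : SimplexSet n) →
           linear f (c ⊕ d) ≗ linear f c ⊕ linear f d
linear-⊕ {n} f c d τ = begin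
  linear f (c ⊕ d) τ
    ≡⟨ linear≡parity f (c ⊕ d) τ ⟩
  parity (map (λ σ → (c σ xor d σ) ∧ f σ τ) (allSubsets n))
    ≡⟨ cong parity (map-cong (λ σ → Bool.∧-distribʳ-xor (f σ τ) (c σ) (d σ)) (allSubsets n)) ⟩
  parity (map (λ σ → (c σ ∧ f σ τ) xor (d σ ∧ f σ τ)) (allSubsets n))
    ≡⟨ parity-xor (λ σ → c σ ∧ f σ τ) (λ σ → d σ ∧ f σ τ) (allSubsets n) ⟩
  parity (map (λ σ → c σ ∧ f σ τ) (allSubsets n)) xor parity (map (λ σ → d σ ∧ f σ τ) (allSubsets n))
    ≡⟨ cong₂ _xor_ (linear≡parity f c τ) (linear≡parity f d τ) ⟨
  linear f c τ xor linear f d τ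
    ∎

-- Equal images cancel mod 2. This serves for `∂` and `δ` as well as for the reference and
-- coreference maps.
linear-⊕≗∅ : ∀ {n} (f : Subset n → SimplexSet n) {c d : SimplexSet n} →
             linear f c ≗ linear f d → linear f (c ⊕ d) ≗ ∅
linear-⊕≗∅ f {c} {d} fc≗fd τ = begin
  linear f (c ⊕ d) τ             ≡⟨ linear-⊕ f c d τ ⟩
  linear f c τ xor linear f d τ  ≡⟨ cong (_xor linear f d τ) (fc≗fd τ) ⟩
  linear f d τ xor linear f d τ  ≡⟨ Bool.xor-same (linear f d τ) ⟩
  false                          ∎

-- All other terms vanish at `τ`, so the coefficient of `σ` in `c` can be read off the image. Since
-- `σ ∈ˢ c` is not assumed, a vanishing image forces `σ` out of `c`.
linear-single : ∀ {n} (f : Subset n → SimplexSet n) (c : SimplexSet n) {σ τ : Subset n} →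
                τ ∈ˢ f σ → (∀ {ρ} → ρ ∈ˢ c → τ ∈ˢ f ρ → ρ ≡ σ) → linear f c τ ≡ c σ
linear-single f c {σ} {τ} τ∈fσ only = begin
  linear f c τ
    ≡⟨ linear≡parity f c τ ⟩
  parity (map (λ ρ → c ρ ∧ f ρ τ) (allSubsets _))
    ≡⟨ parity-single (λ ρ → c ρ ∧ f ρ τ) σ
         (λ ρ t → only (Bool.∧-conicalˡ (c ρ) (f ρ τ) t) (Bool.∧-conicalʳ (c ρ) (f ρ τ) t)) ⟩
  c σ ∧ f σ τ
    ≡⟨ cong (c σ ∧_) τ∈fσ ⟩
  c σ ∧ true
    ≡⟨ Bool.∧-identityʳ (c σ) ⟩
  c σ
    ∎

∈｛｝⇒≡ : ∀ {n} {σ ν : Subset n} → σ ∈ˢ ｛ ν ｝ → σ ≡ ν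
∈｛｝⇒≡ {σ = σ} {ν} = ⌊⌋≡true⇒ (≡-dec Bool._≟_ σ ν)

∈｛｝ : ∀ {n} (ν : Subset n) → ν ∈ˢ ｛ ν ｝
∈｛｝ ν = ⇒⌊⌋≡true (≡-dec Bool._≟_ ν ν) refl

-- On chains supported on `P` and `Q`, the map `f` acts as the projection onto the `P`-part. Here
-- `P` stands for the critical simplices, and `Q` for the upper regular ones (reference) or the
-- lower regular ones (coreference).
linear-restriction : ∀ {n} {f : Subset n → SimplexSet n} {c : SimplexSet n} {P Q : Subset n → Set} →
  (∀ {ν} → P ν → f ν ≗ ｛ ν ｝) → (∀ {ν} → Q ν → f ν ≗ ∅) → c ⊆ˢ (λ ν → P ν ⊎ Q ν) →
  ∀ {ν} → P ν → linear f c ν ≡ c ν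
linear-restriction {f = f} {c} {P} {Q} onP onQ c⊆P⊎Q {ν} Pν =
  linear-single f c (trans (onP Pν ν) (∈｛｝ ν)) λ ρ∈c ν∈fρ → only ν∈fρ (c⊆P⊎Q ρ∈c)
  where
  only : ∀ {ρ} → ν ∈ˢ f ρ → P ρ ⊎ Q ρ → ρ ≡ ν
  only ν∈fρ (inj₁ Pρ) = sym (∈｛｝⇒≡ (trans (sym (onP Pρ ν)) ν∈fρ))
  only ν∈fρ (inj₂ Qρ) = contradiction (trans (sym (onQ Qρ ν)) ν∈fρ) λ ()

-- Free pairs

∣p∪⁅x⁆∣≡1+∣p∣ : ∀ {n} (p : Subset n) x → x ∉ p → ∣ p ∪ ⁅ x ⁆ ∣ ≡ suc ∣ p ∣
∣p∪⁅x⁆∣≡1+∣p∣ (outside ∷ᵛ p) zero    x∉p = cong (suc ∘ ∣_∣) (∪-identityʳ p)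
∣p∪⁅x⁆∣≡1+∣p∣ (inside  ∷ᵛ p) zero    x∉p = contradiction here x∉p
∣p∪⁅x⁆∣≡1+∣p∣ (outside ∷ᵛ p) (suc x) x∉p = ∣p∪⁅x⁆∣≡1+∣p∣ p x (x∉p ∘ there)
∣p∪⁅x⁆∣≡1+∣p∣ (inside  ∷ᵛ p) (suc x) x∉p = cong suc (∣p∪⁅x⁆∣≡1+∣p∣ p x (x∉p ∘ there))

suc-dim : ∀ {n} {σ : Subset n} → Nonempty σ → suc (dim σ) ≡ ∣ σ ∣
-- Removing `x` strictly decreases the cardinality, which is therefore positive, and `pred` does not
-- truncate.
suc-dim {σ = σ} (_ , x∈σ) = suc-pred ∣ σ ∣ {{>-nonZero (m<n⇒0<n (x∈p⇒∣p-x∣<∣p∣ x∈σ))}}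

-- For x ∈ τ ∖ σ the simplex σ ∪ ⁅ x ⁆ lies in K, hence equals τ by freeness.
free-codim-1 : ∀ {n} {K : SimplicialComplex n} {σ τ} → FreePair K σ τ → suc (dim σ) ≡ dim τ
free-codim-1 {K = K} {σ} {τ} fp = begin
  suc (dim σ)           ≡⟨ suc-dim (nonempty K lower∈) ⟩
  ∣ σ ∣                 ≡⟨⟩
  pred (suc ∣ σ ∣)      ≡⟨ cong pred (∣p∪⁅x⁆∣≡1+∣p∣ σ x x∉σ) ⟨
  dim (σ ∪ ⁅ x ⁆)       ≡⟨ cong dim (only σ∪x∈K (p⊆p∪q ⁅ x ⁆) σ∪x≢σ) ⟩
  dim τ                 ∎
  where
  open FreePair fp
  x = proj₁ (proj₂ proper)
  x∈τ = proj₁ (proj₂ (proj₂ proper))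
  x∉σ = proj₂ (proj₂ (proj₂ proper))

  σ∪x⊆τ : σ ∪ ⁅ x ⁆ ⊆ τ
  σ∪x⊆τ y∈ with x∈p∪q⁻ σ ⁅ x ⁆ y∈
  ... | inj₁ y∈σ = proj₁ proper y∈σ
  ... | inj₂ y∈x = subst (_∈ τ) (sym (x∈⁅y⁆⇒x≡y x y∈x)) x∈τ

  σ∪x∈K : σ ∪ ⁅ x ⁆ ∈ᴷ K
  σ∪x∈K = closed K upper∈ (x , q⊆p∪q σ ⁅ x ⁆ (x∈⁅x⁆ x)) σ∪x⊆τ

  σ∪x≢σ : σ ∪ ⁅ x ⁆ ≢ σ
  σ∪x≢σ eq = x∉σ (subst (x ∈_) eq (q⊆p∪q σ ⁅ x ⁆ (x∈⁅x⁆ x)))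

-- Incidence in boundaries and coboundaries

∈boundary⇒⊂ : ∀ {n} (K : SimplicialComplex n) {σ τ} → σ ∈ˢ boundary K τ → σ ⊂ τ
∈boundary⇒⊂ K {σ} {τ} t =
  ⌊⌋≡true⇒ (σ ⊂? τ)
    (Bool.∧-conicalʳ ⌊ suc (dim σ) ≟ dim τ ⌋ _ (Bool.∧-conicalʳ (simplices K σ) _ t))

∈boundary : ∀ {n} (K : SimplicialComplex n) {σ τ} →
            σ ∈ᴷ K → suc (dim σ) ≡ dim τ → σ ⊂ τ → σ ∈ˢ boundary K τ
∈boundary K {σ} {τ} σ∈K eq σ⊂τ =
  cong₂ _∧_ σ∈K (cong₂ _∧_ (⇒⌊⌋≡true (suc (dim σ) ≟ dim τ) eq) (⇒⌊⌋≡true (σ ⊂? τ) σ⊂τ))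

∈coboundary⇒⊂ : ∀ {n} (K : SimplicialComplex n) {σ τ} → τ ∈ˢ coboundary K σ → σ ⊂ τ
∈coboundary⇒⊂ K {σ} {τ} t =
  ⌊⌋≡true⇒ (σ ⊂? τ)
    (Bool.∧-conicalʳ ⌊ dim τ ≟ suc (dim σ) ⌋ _ (Bool.∧-conicalʳ (simplices K τ) _ t))

∈coboundary : ∀ {n} (K : SimplicialComplex n) {σ τ} →
              τ ∈ᴷ K → dim τ ≡ suc (dim σ) → σ ⊂ τ → τ ∈ˢ coboundary K σ
∈coboundary K {σ} {τ} τ∈K eq σ⊂τ =
  cong₂ _∧_ τ∈K (cong₂ _∧_ (⇒⌊⌋≡true (dim τ ≟ suc (dim σ)) eq) (⇒⌊⌋≡true (σ ⊂? τ) σ⊂τ))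

-- Morse sequences

infix 4 _⊆ᴷ_

_⊆ᴷ_ : ∀ {n} → SimplicialComplex n → SimplicialComplex n → Set
L ⊆ᴷ K = ∀ {ρ} → ρ ∈ᴷ L → ρ ∈ᴷ K

expansion-⊆ : ∀ {n} {K L : SimplicialComplex n} {σ τ} → Expansion K L σ τ → K ⊆ᴷ L
expansion-⊆ e ρ∈K = proj₁ (Equivalence.to (Expansion.remove e _) ρ∈K)

filling-⊆ : ∀ {n} {K L : SimplicialComplex n} {ν} → Filling K L ν → K ⊆ᴷ L
filling-⊆ f ρ∈K = proj₁ (Equivalence.to (Filling.remove f _) ρ∈K)

expansion-cases : ∀ {n} {K L : SimplicialComplex n} {σ τ} → Expansion K L σ τ →
                  ∀ {ρ} → ρ ∈ᴷ L → ρ ∈ᴷ K ⊎ ρ ≡ σ ⊎ ρ ≡ τ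
expansion-cases {σ = σ} {τ} e {ρ} ρ∈L with ≡-dec Bool._≟_ ρ σ | ≡-dec Bool._≟_ ρ τ
... | yes ρ≡σ | _       = inj₂ (inj₁ ρ≡σ)
... | no _    | yes ρ≡τ = inj₂ (inj₂ ρ≡τ)
... | no ρ≢σ  | no ρ≢τ  = inj₁ (Equivalence.from (Expansion.remove e ρ) (ρ∈L , ρ≢σ , ρ≢τ))

filling-cases : ∀ {n} {K L : SimplicialComplex n} {ν} → Filling K L ν →
                ∀ {ρ} → ρ ∈ᴷ L → ρ ∈ᴷ K ⊎ ρ ≡ ν
filling-cases {ν = ν} f {ρ} ρ∈L with ≡-dec Bool._≟_ ρ ν
... | yes ρ≡ν = inj₂ ρ≡ν
... | no ρ≢ν  = inj₁ (Equivalence.from (Filling.remove f ρ) (ρ∈L , ρ≢ν))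

upper∈K : ∀ {n} {K : SimplicialComplex n} (W : MorseSequence K) {τ} → UpperRegular W τ → τ ∈ᴷ K
upper∈K (expand W _ _ e) (inj₁ refl) = FreePair.upper∈ (Expansion.free e)
upper∈K (expand W _ _ e) (inj₂ u)    = expansion-⊆ e (upper∈K W u)
upper∈K (fill W _ f)     u           = filling-⊆ f (upper∈K W u)

-- The step at which a simplex is added determines its type. In the cohomological half, where the
-- support condition only excludes upper regular simplices, this leaves the critical and the lower
-- regular ones.
classify : ∀ {n} {K : SimplicialComplex n} (W : MorseSequence K) {ρ} → ρ ∈ᴷ K →
           Critical W ρ ⊎ LowerRegular W ρ ⊎ UpperRegular W ρ
classify (start K≗∅) {ρ} ρ∈K = contradiction (trans (sym (K≗∅ ρ)) ρ∈K) λ ()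
classify (expand W _ _ e) ρ∈L with expansion-cases e ρ∈L
... | inj₂ (inj₁ ρ≡σ) = inj₂ (inj₁ (inj₁ ρ≡σ))
... | inj₂ (inj₂ ρ≡τ) = inj₂ (inj₂ (inj₁ ρ≡τ))
... | inj₁ ρ∈K with classify W ρ∈K
...   | inj₁ c        = inj₁ c
...   | inj₂ (inj₁ l) = inj₂ (inj₁ (inj₂ l))
...   | inj₂ (inj₂ u) = inj₂ (inj₂ (inj₂ u))
classify (fill W _ f) ρ∈L with filling-cases f ρ∈L
... | inj₂ ρ≡ν = inj₁ (inj₁ ρ≡ν)
... | inj₁ ρ∈K with classify W ρ∈K
...   | inj₁ c = inj₁ (inj₂ c)
...   | inj₂ r = inj₂ r

-- The induction shortens M while ∂ and δ remain those of the full complex K.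

upper-cycle-empty : ∀ {n} (K : SimplicialComplex n) {L : SimplicialComplex n} (M : MorseSequence L) → L ⊆ᴷ K →
                    {c : SimplexSet n} → ∂ K c ≗ ∅ → c ⊆ˢ UpperRegular M → ∀ {ρ} → ¬ ρ ∈ˢ c
upper-cycle-empty K (start _) _ _ c⊆U ρ∈c = c⊆U ρ∈c
upper-cycle-empty K (fill M _ f) L⊆K ∂c≗∅ c⊆U = upper-cycle-empty K M (L⊆K ∘ filling-⊆ f) ∂c≗∅ c⊆U
upper-cycle-empty K (expand M σ τ e) L⊆K {c} ∂c≗∅ c⊆U =
  -- Once `τ` is excluded, `c` is supported on the upper regular simplices of the shorter sequence
  -- `M`.
  upper-cycle-empty K M (L⊆K ∘ expansion-⊆ e) ∂c≗∅ λ ρ∈c →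
    [ (λ { refl → contradiction ρ∈c τ∉c }) , id ] (c⊆U ρ∈c)
  where
  open FreePair (Expansion.free e)

  only-coface : ∀ {ρ} → ρ ∈ˢ c → σ ∈ˢ boundary K ρ → ρ ≡ τ
  only-coface ρ∈c σ∈∂ρ with ∈boundary⇒⊂ K σ∈∂ρ
  -- In `K` the simplex `σ` may have cofaces added after `L`, but the members of `c` are upper
  -- regular in the present sequence, hence lie in `L`, where the pair is free.
  ... | σ⊆ρ , x , x∈ρ , x∉σ = only (upper∈K (expand M σ τ e) (c⊆U ρ∈c)) σ⊆ρ λ { refl → x∉σ x∈ρ }

  cτ≡false : c τ ≡ false
  cτ≡false = trans
    (sym (linear-single (boundary K) c
            (∈boundary K (L⊆K lower∈) (free-codim-1 (Expansion.free e)) proper) only-coface))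
    (∂c≗∅ σ)

  τ∉c : ¬ τ ∈ˢ c
  τ∉c = Bool.not-¬ cτ≡false

-- Lower simplices are eliminated from the earliest on, so `c` may still contain simplices of `K`
-- added after `L`. The conclusion therefore concerns only members of `L`, while `c` itself is
-- merely supported in `K`.
lower-cocycle-empty : ∀ {n} (K : SimplicialComplex n) {L : SimplicialComplex n} (M : MorseSequence L) → L ⊆ᴷ K →
                      {c : SimplexSet n} → δ K c ≗ ∅ → c ⊆ˢ (_∈ᴷ K) →
                      (∀ {ρ} → Critical M ρ → ¬ ρ ∈ˢ c) → (∀ {ρ} → UpperRegular M ρ → ¬ ρ ∈ˢ c) →
                      ∀ {ρ} → ρ ∈ᴷ L → ¬ ρ ∈ˢ c
lower-cocycle-empty K (start L≗∅) _ _ _ _ _ {ρ} ρ∈L = contradiction (trans (sym (L≗∅ ρ)) ρ∈L) λ ()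
lower-cocycle-empty K (fill M _ f) L⊆K δc≗∅ c⊆K C∉c U∉c ρ∈L with filling-cases f ρ∈L
... | inj₁ ρ∈M = lower-cocycle-empty K M (L⊆K ∘ filling-⊆ f) δc≗∅ c⊆K (C∉c ∘ inj₂) U∉c ρ∈M
... | inj₂ ρ≡ν = C∉c (inj₁ ρ≡ν)
lower-cocycle-empty K {L} (expand M σ τ e) L⊆K {c} δc≗∅ c⊆K C∉c U∉c ρ∈L
  with expansion-cases e ρ∈L
... | inj₁ ρ∈M         = lower-cocycle-empty K M (L⊆K ∘ expansion-⊆ e) δc≗∅ c⊆K C∉c (U∉c ∘ inj₂) ρ∈M
... | inj₂ (inj₂ ρ≡τ)  = U∉c (inj₁ ρ≡τ)
... | inj₂ (inj₁ refl) = Bool.not-¬ cσ≡false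
  where
  open FreePair (Expansion.free e)

  only-face : ∀ {ρ} → ρ ∈ˢ c → τ ∈ˢ coboundary K ρ → ρ ≡ σ
  only-face ρ∈c τ∈δρ
    -- Closure of `L` under faces puts every face of `τ` into `L`: it is either `σ` or `τ` itself,
    -- or it was added earlier and is excluded by induction.
    with expansion-cases e (closed L upper∈ (nonempty K (c⊆K ρ∈c)) (proj₁ (∈coboundary⇒⊂ K τ∈δρ)))
  ... | inj₁ ρ∈M = contradiction ρ∈c
        (lower-cocycle-empty K M (L⊆K ∘ expansion-⊆ e) δc≗∅ c⊆K C∉c (U∉c ∘ inj₂) ρ∈M)
  ... | inj₂ (inj₁ ρ≡σ) = ρ≡σ
  ... | inj₂ (inj₂ ρ≡τ) = contradiction ρ∈c (U∉c (inj₁ ρ≡τ))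

  cσ≡false : c σ ≡ false
  cσ≡false = trans
    (sym (linear-single (coboundary K) c
            (∈coboundary K (L⊆K upper∈) (sym (free-codim-1 (Expansion.free e))) proper) only-face))
    (δc≗∅ τ)

-- Uniqueness of cycles and cocycles

⊕-empty⇒≗ : ∀ {n} {z z′ : SimplexSet n} → (∀ {ρ} → ¬ ρ ∈ˢ z ⊕ z′) → z ≗ z′
⊕-empty⇒≗ {z = z} {z′} empty ρ = xor≡false⇒≡ (z ρ) (z′ ρ) (Bool.¬-not empty)

reference-injective : ∀ {n} {K : SimplicialComplex n} (W : MorseSequence K)
  {⋏ : Subset n → SimplexSet n} → IsReference W ⋏ →
  ∀ {p} {z z′ : SimplexSet n} → IsCycle K p z → IsCycle K p z′ →
  linear ⋏ z ≗ linear ⋏ z′ → z ⊆ˢ W⁺ W p → z′ ⊆ˢ W⁺ W p → z ≗ z′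
reference-injective {n} {K} W {⋏} ref {p} {z} {z′} cyc cyc′ ⋏z≗⋏z′ z⊆W⁺ z′⊆W⁺ =
  ⊕-empty⇒≗ (upper-cycle-empty K W id ∂c≗∅ c⊆U)
  where
  open IsReference ref

  chain⊆ : ∀ {y} → IsCycle K p y → y ⊆ˢ W⁺ W p → y ⊆ˢ λ ν → Critical W ν ⊎ UpperRegular W ν
  chain⊆ y-cyc y⊆W⁺ ν∈y with y⊆W⁺ ν∈y
  ... | inj₁ (cu , _)  = cu
  -- The lower regular simplices in the skeleton have dimension below `p`, whereas a `p`-chain has
  -- only simplices of dimension exactly `p`.
  ... | inj₂ (_ , d<p) = contradiction d<p (<-irrefl (proj₂ (IsCycle.chain y-cyc ν∈y)))

  c⊆C⊎U : z ⊕ z′ ⊆ˢ λ ν → Critical W ν ⊎ UpperRegular W ν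
  c⊆C⊎U = ⊕⊆ {S = z} {z′} (chain⊆ cyc z⊆W⁺) (chain⊆ cyc′ z′⊆W⁺)

  ∂c≗∅ : ∂ K (z ⊕ z′) ≗ ∅
  ∂c≗∅ = linear-⊕≗∅ (boundary K) λ τ → trans (IsCycle.closed cyc τ) (sym (IsCycle.closed cyc′ τ))

  C∉c : ∀ {ν} → Critical W ν → ¬ ν ∈ˢ z ⊕ z′
  -- The coefficient of `ν` in `z ⊕ z′` equals its coefficient in the image under `⋏`, which is
  -- zero.
  C∉c {ν} Cν = Bool.not-¬
    (trans (sym (linear-restriction critical upper c⊆C⊎U Cν)) (linear-⊕≗∅ ⋏ ⋏z≗⋏z′ ν))

  c⊆U : z ⊕ z′ ⊆ˢ UpperRegular W
  c⊆U ν∈c = [ (λ Cν → contradiction ν∈c (C∉c Cν)) , id ] (c⊆C⊎U ν∈c)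

coreference-injective : ∀ {n} {K : SimplicialComplex n} (W : MorseSequence K)
  {⋎ : Subset n → SimplexSet n} → IsCoreference W ⋎ →
  ∀ {p} {z z′ : SimplexSet n} → IsCocycle K p z → IsCocycle K p z′ →
  linear ⋎ z ≗ linear ⋎ z′ → z ⊆ˢ W⁻ᶜ W p → z′ ⊆ˢ W⁻ᶜ W p → z ≗ z′
coreference-injective {n} {K} W {⋎} coref {p} {z} {z′} coc coc′ ⋎z≗⋎z′ z⊆ z′⊆ =
  ⊕-empty⇒≗ λ ρ∈c → lower-cocycle-empty K W id δc≗∅ c⊆K C∉c U∉c (c⊆K ρ∈c) ρ∈c
  where
  open IsCoreference coref

  chain⊆ : ∀ {y} → IsCocycle K p y → y ⊆ˢ W⁻ᶜ W p → y ⊆ˢ λ ν → ν ∈ᴷ K × ¬ UpperRegular W ν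
  chain⊆ y-coc y⊆ ν∈y =
    proj₁ (y⊆ ν∈y) ,
    -- Since `dim ν` equals `p`, an upper regular `ν` would belong to the excluded skeleton.
    λ u → proj₂ (y⊆ ν∈y) (inj₁ (u , ≤-reflexive (proj₂ (IsCocycle.chain y-coc ν∈y))))

  c⊆K∖U : z ⊕ z′ ⊆ˢ λ ν → ν ∈ᴷ K × ¬ UpperRegular W ν
  c⊆K∖U = ⊕⊆ {S = z} {z′} (chain⊆ coc z⊆) (chain⊆ coc′ z′⊆)

  c⊆K : z ⊕ z′ ⊆ˢ (_∈ᴷ K)
  c⊆K = proj₁ ∘ c⊆K∖U

  U∉c : ∀ {ν} → UpperRegular W ν → ¬ ν ∈ˢ z ⊕ z′
  U∉c u ν∈c = proj₂ (c⊆K∖U ν∈c) u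

  c⊆C⊎L : z ⊕ z′ ⊆ˢ λ ν → Critical W ν ⊎ LowerRegular W ν
  c⊆C⊎L ν∈c with classify W (c⊆K ν∈c)
  ... | inj₁ c        = inj₁ c
  ... | inj₂ (inj₁ l) = inj₂ l
  ... | inj₂ (inj₂ u) = contradiction ν∈c (U∉c u)

  δc≗∅ : δ K (z ⊕ z′) ≗ ∅
  δc≗∅ = linear-⊕≗∅ (coboundary K) λ τ → trans (IsCocycle.closed coc τ) (sym (IsCocycle.closed coc′ τ))

  C∉c : ∀ {ν} → Critical W ν → ¬ ν ∈ˢ z ⊕ z′
  C∉c {ν} Cν = Bool.not-¬
    (trans (sym (linear-restriction critical lower c⊆C⊎L Cν)) (linear-⊕≗∅ ⋎ ⋎z≗⋎z′ ν))

theorem7 : ∀ {n : ℕ} {K : SimplicialComplex n} (W : MorseSequence K)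
    (⋏ ⋎ : Subset n → SimplexSet n) → IsReference W ⋏ → IsCoreference W ⋎ →
    (∀ (p : ℕ) (z z′ : SimplexSet n) → IsCycle K p z → IsCycle K p z′ →
    linear ⋏ z ≗ linear ⋏ z′ → z ⊆ˢ W⁺ W p → z′ ⊆ˢ W⁺ W p → z ≗ z′)
    ×
    (∀ (p : ℕ) (z z′ : SimplexSet n) → IsCocycle K p z → IsCocycle K p z′ →
    linear ⋎ z ≗ linear ⋎ z′ → z ⊆ˢ W⁻ᶜ W p → z′ ⊆ˢ W⁻ᶜ W p → z ≗ z′)
theorem7 W ⋏ ⋎ ref coref =
  (λ _ _ _ → reference-injective W ref) , (λ _ _ _ → coreference-injective W coref)
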